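{- The vertex-Turán density of $Q_7$ is greater than $7/8$. Equivalently, $\gamma_7 < 1/8$.
   Context: Let $Q_n$ denote the $n$-dimensional discrete cube with vertex set $\{0,1\}^n$, two vectors being adjacent if they differ in exactly one coordinate. A copy of $Q_d$ in $Q_n$ is the vertex set of a $d$-dimensional subcube, i.e. a set of the form $\{x \in \{0,1\}^n : x_i = a_i \text{ for all } i \notin I\}$ for some $I \subset [n]$ with $|I| = d$ and some fixed values $a_i \in \{0,1\}$. Let $\mathrm{exc}(n,Q_d)$ be the maximum size of a subset of $\{0,1\}^n$ containing no copy of $Q_d$, and define the vertex-Turán density $\lambda(Q_d) = \lim_{n\to\infty} \mathrm{exc}(n,Q_d)/2^n$ (this limit exists). Let $g(n,d)$ be the minimum size of a subset of $\{0,1\}^n$ that intersects every copy of $Q_d$, and $\gamma_d = \lim_{n\to\infty} g(n,d)/2^n$, so that $\gamma_d = 1 - \lambda(Q_d)$. -}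

module Defs where

open import Data.Bool using (Bool; true; false; if_then_else_)
open import Data.Nat using (ℕ; zero; suc; _+_)
open import Data.List using (List; []; _∷_; map; _++_)
open import Data.Nat.ListAction using (sum)
open import Data.Vec using (Vec; lookup) renaming ([] to []ᵥ; _∷_ to _∷ᵥ_)
open import Data.Fin using (Fin)
open import Data.Product using (Σ; _×_)
open import Relation.Binary.PropositionalEquality using (_≡_)
open import Relation.Nullary using (¬_)

cube : (n : ℕ) → List (Vec Bool n)
cube zero = []ᵥ ∷ []
cube (suc n) = map (true ∷ᵥ_) (cube n) ++ map (false ∷ᵥ_) (cube n)

VSet : ℕ → Set
VSet n = Vec Bool n → Bool

size : {n : ℕ} → VSet n → ℕ
size {n} A = sum (map (λ x → if A x then 1 else 0) (cube n))

-- Number of coordinates equal to true (|I| for I ⊆ [n] given as a mask).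
weight : {n : ℕ} → Vec Bool n → ℕ
weight []ᵥ = 0
weight (true ∷ᵥ v) = suc (weight v)
weight (false ∷ᵥ v) = weight v

-- x lies in the subcube {x : x_i = a_i for all i ∉ I}, I given as a mask.
InSubcube : {n : ℕ} → Vec Bool n → Vec Bool n → Vec Bool n → Set
InSubcube {n} I a x = (i : Fin n) → lookup I i ≡ false → lookup x i ≡ lookup a i

ContainsCopy : {n : ℕ} → ℕ → VSet n → Set
ContainsCopy {n} d A =
  Σ (Vec Bool n) λ I → Σ (Vec Bool n) λ a →
    (weight I ≡ d) × ((x : Vec Bool n) → InSubcube I a x → A x ≡ true)

QdFree : {n : ℕ} → ℕ → VSet n → Set
QdFree d A = ¬ ContainsCopy d A

{-# OPTIONS --safe #-}
-- Random linear algebra over the field 𝔽 with four elements. Fix a matrix φ over 𝔽 with n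
-- columns; call a set x of r columns degenerate if these columns, restricted to the first r
-- rows, are linearly dependent. For random φ a union bound over the (4^r − 1)/3 possible
-- dependencies up to scaling shows that x is degenerate with probability below 1/3. Let A omit
-- exactly the degenerate sets whose size lies in a fixed residue class mod 4; for a suitable φ
-- and class A has density at least 1 − 1/12 > 7/8.
-- Every Q_7 = { S ∪ X : X ⊆ T } has a layer |X| = s with 2 ≤ s ≤ 5 in the chosen class. If A
-- contained it, the dependencies among the columns S ∪ T would project to a linear code in
-- 𝔽^T in which no nonzero word has weight ≤ s, but every (s+1)-subset of T is the support of
-- some word. Among suitable such supports, pigeonhole on the three nonzero scalars gives two
-- words proportional on two coordinates, and combining them yields a nonzero word of weight s.
module Submission where

open import Defs
open import Data.Nat using (ℕ; _+_; _*_; _^_; _≤_; _<_)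
open import Data.Product using (Σ; _×_)

open import Data.Bool using (Bool; true; false; if_then_else_; _∧_; _∨_; not)
open import Data.Bool.ListAction using (any)
open import Data.Bool.Properties using () renaming (_≟_ to _≟ᵇ_)
open import Data.Empty using (⊥; ⊥-elim)
open import Data.Fin as Fin using (Fin; combine; remQuot; punchOut)
open import Data.Fin.Patterns using (0F; 1F; 2F; 3F; 4F)
open import Data.Fin.Properties as Finₚ using (all?; pigeonhole; combine-injective; combine-remQuot; punchOut-injective)
open import Data.List using (List; []; _∷_; _++_; map; length; cartesianProductWith)
open import Data.List.Membership.Propositional using (_∈_)
open import Data.List.Membership.Propositional.Properties using (∈-map⁺; ∈-++⁺ˡ; ∈-++⁺ʳ; ∈-cartesianProductWith⁺)
open import Data.List.Properties using (length-map; length-++; map-∘)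
open import Data.List.Relation.Unary.All as All using (All; []; _∷_)
open import Data.List.Relation.Unary.All.Properties using (map⁺; ++⁺)
open import Data.List.Relation.Unary.Any using (here; there)
open import Data.Nat using (zero; suc; z≤n; s≤s; NonZero)
open import Data.Nat.ListAction using (sum)
open import Data.Nat.Properties
open import Data.Nat.Tactic.RingSolver using (solve-∀)
open import Data.Product using (∃; ∃₂; _,_; proj₁; proj₂; uncurry)
open import Data.Sum using (_⊎_; inj₁; inj₂)
open import Data.Vec as Vec using (Vec; lookup; replicate; zipWith; _[_]≔_) renaming ([] to []ᵥ; _∷_ to _∷ᵥ_)
open import Data.Vec.Properties using (∷-injective; lookup-zipWith; lookup-map; lookup-replicate)
open import Function using (_∘_)
open import Relation.Binary.PropositionalEquality using (_≡_; _≢_; refl; sym; trans; cong; cong₂; subst; module ≡-Reasoning)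
open import Relation.Nullary using (¬_; Dec; yes; no)
open import Relation.Nullary.Decidable using (from-yes; ¬?; _→-dec_; _×-dec_; _⊎-dec_; ⌊_⌋)

private
  variable
    X Y Z : Set
    m n r d : ℕ

-- Finite sums

∑ : List X → (X → ℕ) → ℕ
∑ xs f = sum (map f xs)

∑-cong : ∀ (xs : List X) {f g} → (∀ x → f x ≡ g x) → ∑ xs f ≡ ∑ xs g
∑-cong []       f≗g = refl
∑-cong (x ∷ xs) f≗g = cong₂ _+_ (f≗g x) (∑-cong xs f≗g)

∑-mono : ∀ (xs : List X) {f g} → (∀ x → f x ≤ g x) → ∑ xs f ≤ ∑ xs g
∑-mono []       f≤g = z≤n
∑-mono (x ∷ xs) f≤g = +-mono-≤ (f≤g x) (∑-mono xs f≤g)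

∑-++ : ∀ (xs ys : List X) f → ∑ (xs ++ ys) f ≡ ∑ xs f + ∑ ys f
∑-++ []       ys f = refl
∑-++ (x ∷ xs) ys f = trans (cong (f x +_) (∑-++ xs ys f)) (sym (+-assoc (f x) _ _))

∑-map : ∀ (h : X → Y) xs f → ∑ (map h xs) f ≡ ∑ xs (f ∘ h)
∑-map h xs f = cong sum (sym (map-∘ xs))

∑-const-All : ∀ {xs : List X} {f k} → All (λ x → f x ≡ k) xs → ∑ xs f ≡ length xs * k
∑-const-All []         = refl
∑-const-All (eq ∷ eqs) = cong₂ _+_ eq (∑-const-All eqs)

∑-const : ∀ (xs : List X) k → ∑ xs (λ _ → k) ≡ length xs * k
∑-const xs k = ∑-const-All (All.universal (λ _ → refl) xs)

∑-distrib-+ : ∀ (xs : List X) f g → ∑ xs (λ x → f x + g x) ≡ ∑ xs f + ∑ xs g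
∑-distrib-+ []       f g = refl
∑-distrib-+ (x ∷ xs) f g rewrite ∑-distrib-+ xs f g = interchange (f x) (g x) _ _
  where
  interchange : ∀ a b c d → a + b + (c + d) ≡ a + c + (b + d)
  interchange = solve-∀

∑-distribˡ-* : ∀ (xs : List X) k f → ∑ xs (λ x → k * f x) ≡ k * ∑ xs f
∑-distribˡ-* []       k f = sym (*-zeroʳ k)
∑-distribˡ-* (x ∷ xs) k f =
  trans (cong (k * f x +_) (∑-distribˡ-* xs k f)) (sym (*-distribˡ-+ k (f x) _))

∑-distribʳ-* : ∀ (xs : List X) k f → ∑ xs (λ x → f x * k) ≡ ∑ xs f * k
∑-distribʳ-* xs k f = begin
  ∑ xs (λ x → f x * k)  ≡⟨ ∑-cong xs (λ x → *-comm (f x) k) ⟩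
  ∑ xs (λ x → k * f x)  ≡⟨ ∑-distribˡ-* xs k f ⟩
  k * ∑ xs f            ≡⟨ *-comm k _ ⟩
  ∑ xs f * k            ∎
  where open ≡-Reasoning

∑-comm : ∀ (xs : List X) (ys : List Y) (f : X → Y → ℕ) →
         ∑ xs (λ x → ∑ ys (f x)) ≡ ∑ ys (λ y → ∑ xs (λ x → f x y))
∑-comm []       ys f = sym (trans (∑-const ys 0) (*-zeroʳ (length ys)))
∑-comm (x ∷ xs) ys f =
  trans (cong (∑ ys (f x) +_) (∑-comm xs ys f)) (sym (∑-distrib-+ ys (f x) _))

∑-cartesianProductWith : ∀ (h : X → Y → Z) xs ys f →
  ∑ (cartesianProductWith h xs ys) f ≡ ∑ xs (λ x → ∑ ys (λ y → f (h x y)))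
∑-cartesianProductWith h []       ys f = refl
∑-cartesianProductWith h (x ∷ xs) ys f =
  trans (∑-++ (map (h x) ys) _ f) (cong₂ _+_ (∑-map (h x) ys f) (∑-cartesianProductWith h xs ys f))

length≡∑1 : ∀ (xs : List X) → length xs ≡ ∑ xs (λ _ → 1)
length≡∑1 xs = sym (trans (∑-const xs 1) (*-identityʳ _))

-- First-moment method with the division multiplied out. The witness need not lie in `xs`: the
-- fallback `x₀` keeps the empty list harmless and may itself be returned.
∃≤average : X → (xs : List X) (f : X → ℕ) → ∃ λ x → length xs * f x ≤ ∑ xs f
∃≤average x₀ []       f = x₀ , z≤n
∃≤average x₀ (x ∷ xs) f with ∃≤average x₀ xs f
... | y , fy≤ with ≤-total (f x) (f y)
...   | inj₁ fx≤fy = x , +-monoʳ-≤ (f x) (≤-trans (*-monoʳ-≤ (length xs) fx≤fy) fy≤)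
...   | inj₂ fy≤fx = y , +-mono-≤ fy≤fx fy≤

𝟙 : Bool → ℕ
𝟙 b = if b then 1 else 0

𝟙-∧ : ∀ b c → 𝟙 (b ∧ c) ≡ 𝟙 b * 𝟙 c
𝟙-∧ true  c = sym (+-identityʳ (𝟙 c))
𝟙-∧ false c = refl

𝟙-not : ∀ b → 𝟙 (not b) + 𝟙 b ≡ 1
𝟙-not true  = refl
𝟙-not false = refl

-- The union bound.
𝟙-any : ∀ (p : X → Bool) xs → 𝟙 (any p xs) ≤ ∑ xs (𝟙 ∘ p)
𝟙-any p []       = z≤n
𝟙-any p (x ∷ xs) with p x
... | true  = s≤s z≤n
... | false = 𝟙-any p xs

any-false : ∀ (p : X → Bool) {xs x} → any p xs ≡ false → x ∈ xs → p x ≡ false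
any-false p {x ∷ xs} none x∈xs with p x in px
any-false p {x ∷ xs} none (here refl)  | false = px
any-false p {x ∷ xs} none (there x∈xs) | false = any-false p none x∈xs

length-cube : ∀ n → length (cube n) ≡ 2 ^ n
length-cube zero    = refl
length-cube (suc n) = begin
  length (map (true ∷ᵥ_) (cube n) ++ map (false ∷ᵥ_) (cube n))
    ≡⟨ length-++ (map (true ∷ᵥ_) (cube n)) ⟩
  length (map (true ∷ᵥ_) (cube n)) + length (map (false ∷ᵥ_) (cube n))
    ≡⟨ cong₂ _+_ (length-map _ (cube n)) (length-map _ (cube n)) ⟩
  length (cube n) + length (cube n)
    ≡⟨ cong₂ _+_ (length-cube n) (trans (length-cube n) (sym (+-identityʳ _))) ⟩
  2 ^ suc n ∎
  where open ≡-Reasoning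

vecs : List X → (m : ℕ) → List (Vec X m)
vecs xs zero    = []ᵥ ∷ []
vecs xs (suc m) = cartesianProductWith _∷ᵥ_ xs (vecs xs m)

length-vecs : ∀ (xs : List X) m → length (vecs xs m) ≡ length xs ^ m
length-vecs xs zero    = refl
length-vecs xs (suc m) = begin
  length (vecs xs (suc m))                  ≡⟨ length≡∑1 (vecs xs (suc m)) ⟩
  ∑ (vecs xs (suc m)) (λ _ → 1)             ≡⟨ ∑-cartesianProductWith _∷ᵥ_ xs (vecs xs m) _ ⟩
  ∑ xs (λ _ → ∑ (vecs xs m) (λ _ → 1))      ≡⟨ ∑-const xs _ ⟩
  length xs * ∑ (vecs xs m) (λ _ → 1)       ≡⟨ cong (length xs *_) (sym (length≡∑1 (vecs xs m))) ⟩
  length xs * length (vecs xs m)            ≡⟨ cong (length xs *_) (length-vecs xs m) ⟩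
  length xs ^ suc m                         ∎
  where open ≡-Reasoning

-- The field with four elements

-- 2F is a root of t² + t + 1 and 3F = 2F + 1; addition is bitwise exclusive or.
𝔽 : Set
𝔽 = Fin 4

infixl 6 _⊕_ _⊕ᵥ_
infixl 7 _⊗_ _⊗ᵥ_

_⊕_ : 𝔽 → 𝔽 → 𝔽
0F ⊕ b  = b
1F ⊕ 0F = 1F
1F ⊕ 1F = 0F
1F ⊕ 2F = 3F
1F ⊕ 3F = 2F
2F ⊕ 0F = 2F
2F ⊕ 1F = 3F
2F ⊕ 2F = 0F
2F ⊕ 3F = 1F
3F ⊕ 0F = 3F
3F ⊕ 1F = 2F
3F ⊕ 2F = 1F
3F ⊕ 3F = 0F

_⊗_ : 𝔽 → 𝔽 → 𝔽
0F ⊗ b  = 0F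
1F ⊗ b  = b
2F ⊗ 0F = 0F
2F ⊗ 1F = 2F
2F ⊗ 2F = 3F
2F ⊗ 3F = 1F
3F ⊗ 0F = 0F
3F ⊗ 1F = 3F
3F ⊗ 2F = 1F
3F ⊗ 3F = 2F

-- The value at `0F` is a placeholder; the laws below assume a non-zero argument.
_⁻¹ : 𝔽 → 𝔽
0F ⁻¹ = 0F
1F ⁻¹ = 1F
2F ⁻¹ = 3F
3F ⁻¹ = 2F

⊕-identityʳ : ∀ a → a ⊕ 0F ≡ a
⊕-identityʳ = from-yes (all? λ a → (a ⊕ 0F) Fin.≟ a)

⊕-interchange : ∀ a b c d → (a ⊕ b) ⊕ (c ⊕ d) ≡ (a ⊕ c) ⊕ (b ⊕ d)
⊕-interchange = from-yes (all? λ a → all? λ b → all? λ c → all? λ d →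
  ((a ⊕ b) ⊕ (c ⊕ d)) Fin.≟ ((a ⊕ c) ⊕ (b ⊕ d)))

⊕-self : ∀ a → a ⊕ a ≡ 0F
⊕-self = from-yes (all? λ a → (a ⊕ a) Fin.≟ 0F)

⊕≡0⇒≡ : ∀ a b → a ⊕ b ≡ 0F → a ≡ b
⊕≡0⇒≡ = from-yes (all? λ a → all? λ b → ((a ⊕ b) Fin.≟ 0F) →-dec (a Fin.≟ b))

⊗-zeroʳ : ∀ a → a ⊗ 0F ≡ 0F
⊗-zeroʳ = from-yes (all? λ a → (a ⊗ 0F) Fin.≟ 0F)

⊗-assoc : ∀ a b c → (a ⊗ b) ⊗ c ≡ a ⊗ (b ⊗ c)
⊗-assoc = from-yes (all? λ a → all? λ b → all? λ c → ((a ⊗ b) ⊗ c) Fin.≟ (a ⊗ (b ⊗ c)))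

⊗-distribˡ-⊕ : ∀ a b c → a ⊗ (b ⊕ c) ≡ a ⊗ b ⊕ a ⊗ c
⊗-distribˡ-⊕ = from-yes (all? λ a → all? λ b → all? λ c →
  (a ⊗ (b ⊕ c)) Fin.≟ (a ⊗ b ⊕ a ⊗ c))

⊗-distribʳ-⊕ : ∀ a b c → (a ⊕ b) ⊗ c ≡ a ⊗ c ⊕ b ⊗ c
⊗-distribʳ-⊕ = from-yes (all? λ a → all? λ b → all? λ c →
  ((a ⊕ b) ⊗ c) Fin.≟ (a ⊗ c ⊕ b ⊗ c))

⁻¹-inverseˡ : ∀ a → a ≢ 0F → a ⁻¹ ⊗ a ≡ 1F
⁻¹-inverseˡ = from-yes (all? λ a → ¬? (a Fin.≟ 0F) →-dec ((a ⁻¹ ⊗ a) Fin.≟ 1F))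

⁻¹≢0 : ∀ a → a ≢ 0F → a ⁻¹ ≢ 0F
⁻¹≢0 = from-yes (all? λ a → ¬? (a Fin.≟ 0F) →-dec ¬? ((a ⁻¹) Fin.≟ 0F))

⊗≢0 : ∀ a b → a ≢ 0F → b ≢ 0F → a ⊗ b ≢ 0F
⊗≢0 = from-yes (all? λ a → all? λ b →
  ¬? (a Fin.≟ 0F) →-dec (¬? (b Fin.≟ 0F) →-dec ¬? ((a ⊗ b) Fin.≟ 0F)))

-- In characteristic two, a + (a/b)b = a + a = 0, so eliminating a coordinate takes no minus sign.
⊕-cancel-quotient : ∀ a b → b ≢ 0F → a ⊕ (a ⊗ b ⁻¹) ⊗ b ≡ 0F
⊕-cancel-quotient = from-yes (all? λ a → all? λ b →
  ¬? (b Fin.≟ 0F) →-dec ((a ⊕ (a ⊗ b ⁻¹) ⊗ b) Fin.≟ 0F))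

-- From c/a = e/b follows (a/b)e = c: the scalar that eliminates a against b also eliminates c
-- against e.
⊕-cancel-proportion : ∀ a b c e → a ≢ 0F → b ≢ 0F → c ⊗ a ⁻¹ ≡ e ⊗ b ⁻¹ → c ⊕ (a ⊗ b ⁻¹) ⊗ e ≡ 0F
⊕-cancel-proportion = from-yes (all? λ a → all? λ b → all? λ c → all? λ e →
  ¬? (a Fin.≟ 0F) →-dec (¬? (b Fin.≟ 0F) →-dec
  (((c ⊗ a ⁻¹) Fin.≟ (e ⊗ b ⁻¹)) →-dec ((c ⊕ (a ⊗ b ⁻¹) ⊗ e) Fin.≟ 0F))))

-- Only three non-zero scalars exist; `punchOut` deletes 0 and lands in `Fin 3`.
𝔽-pigeonhole : (f : Fin 4 → 𝔽) → (∀ i → f i ≢ 0F) → ∃₂ λ i j → i Fin.< j × f i ≡ f j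
𝔽-pigeonhole f f≢0 with pigeonhole (≤-refl {4}) (λ i → punchOut (f≢0 i ∘ sym))
... | i , j , i<j , eq = i , j , i<j , punchOut-injective (f≢0 i ∘ sym) (f≢0 j ∘ sym) eq

-- Vectors, matrices and syndromes

_⊕ᵥ_ : Vec 𝔽 n → Vec 𝔽 n → Vec 𝔽 n
_⊕ᵥ_ = zipWith _⊕_

_⊗ᵥ_ : 𝔽 → Vec 𝔽 n → Vec 𝔽 n
a ⊗ᵥ u = Vec.map (a ⊗_) u

𝟎 : Vec 𝔽 n
𝟎 {n} = replicate n 0F

𝟎-⊕ : 𝟎 ⊕ᵥ 𝟎 ≡ 𝟎 {n}
𝟎-⊕ {zero}  = refl
𝟎-⊕ {suc n} = cong (0F ∷ᵥ_) 𝟎-⊕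

⊗-𝟎 : ∀ a → a ⊗ᵥ 𝟎 ≡ 𝟎 {n}
⊗-𝟎 {zero}  a = refl
⊗-𝟎 {suc n} a = cong₂ _∷ᵥ_ (⊗-zeroʳ a) (⊗-𝟎 a)

⊕ᵥ-self : ∀ (u : Vec 𝔽 n) → u ⊕ᵥ u ≡ 𝟎
⊕ᵥ-self []ᵥ      = refl
⊕ᵥ-self (a ∷ᵥ u) = cong₂ _∷ᵥ_ (⊕-self a) (⊕ᵥ-self u)

⊕ᵥ≡𝟎⇒≡ : ∀ (u v : Vec 𝔽 n) → u ⊕ᵥ v ≡ 𝟎 → u ≡ v
⊕ᵥ≡𝟎⇒≡ []ᵥ      []ᵥ      _  = refl
⊕ᵥ≡𝟎⇒≡ (a ∷ᵥ u) (b ∷ᵥ v) eq with ∷-injective eq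
... | a⊕b≡0 , u⊕v≡𝟎 = cong₂ _∷ᵥ_ (⊕≡0⇒≡ a b a⊕b≡0) (⊕ᵥ≡𝟎⇒≡ u v u⊕v≡𝟎)

dot : Vec 𝔽 n → Vec 𝔽 n → 𝔽
dot []ᵥ      []ᵥ      = 0F
dot (a ∷ᵥ u) (b ∷ᵥ v) = a ⊗ b ⊕ dot u v

dot-⊕ : ∀ (u v w : Vec 𝔽 n) → dot (u ⊕ᵥ v) w ≡ dot u w ⊕ dot v w
dot-⊕ []ᵥ      []ᵥ      []ᵥ      = refl
dot-⊕ (a ∷ᵥ u) (b ∷ᵥ v) (c ∷ᵥ w) rewrite ⊗-distribʳ-⊕ a b c | dot-⊕ u v w =
  ⊕-interchange (a ⊗ c) (b ⊗ c) _ _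

dot-⊗ : ∀ a (u w : Vec 𝔽 n) → dot (a ⊗ᵥ u) w ≡ a ⊗ dot u w
dot-⊗ a []ᵥ      []ᵥ      = sym (⊗-zeroʳ a)
dot-⊗ a (b ∷ᵥ u) (c ∷ᵥ w) rewrite ⊗-assoc a b c | dot-⊗ a u w =
  sym (⊗-distribˡ-⊕ a (b ⊗ c) _)

Matrix : ℕ → ℕ → Set
Matrix m n = Vec (Vec 𝔽 n) m

-- Padded with zeros if φ has fewer than r rows.
syndrome : ∀ r → Matrix m n → Vec 𝔽 n → Vec 𝔽 r
syndrome zero    φ        u = []ᵥ
syndrome (suc r) []ᵥ      u = 0F ∷ᵥ syndrome r []ᵥ u
syndrome (suc r) (ρ ∷ᵥ φ) u = dot u ρ ∷ᵥ syndrome r φ u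

syndrome-⊕ : ∀ r (φ : Matrix m n) u v → syndrome r φ (u ⊕ᵥ v) ≡ syndrome r φ u ⊕ᵥ syndrome r φ v
syndrome-⊕ zero    φ        u v = refl
syndrome-⊕ (suc r) []ᵥ      u v = cong (0F ∷ᵥ_) (syndrome-⊕ r []ᵥ u v)
syndrome-⊕ (suc r) (ρ ∷ᵥ φ) u v = cong₂ _∷ᵥ_ (dot-⊕ u v ρ) (syndrome-⊕ r φ u v)

syndrome-⊗ : ∀ r (φ : Matrix m n) a u → syndrome r φ (a ⊗ᵥ u) ≡ a ⊗ᵥ syndrome r φ u
syndrome-⊗ zero    φ        a u = refl
syndrome-⊗ (suc r) []ᵥ      a u = cong₂ _∷ᵥ_ (sym (⊗-zeroʳ a)) (syndrome-⊗ r []ᵥ a u)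
syndrome-⊗ (suc r) (ρ ∷ᵥ φ) a u = cong₂ _∷ᵥ_ (dot-⊗ a u ρ) (syndrome-⊗ r φ a u)

isZero : 𝔽 → Bool
isZero a = ⌊ a Fin.≟ 0F ⌋

isZeroᵥ : Vec 𝔽 n → Bool
isZeroᵥ []ᵥ      = true
isZeroᵥ (a ∷ᵥ u) = isZero a ∧ isZeroᵥ u

isZeroᵥ-𝟎 : isZeroᵥ (𝟎 {n}) ≡ true
isZeroᵥ-𝟎 {zero}  = refl
isZeroᵥ-𝟎 {suc n} = isZeroᵥ-𝟎 {n}

-- Words supported on a given set of coordinates

infix 4 _◂_

-- In `on` the entry may be zero, so the support is merely contained in the set and these words form
-- a subspace.
data _◂_ : Vec 𝔽 n → Vec Bool n → Set where
  []  : []ᵥ ◂ []ᵥ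
  on  : ∀ {a} {u : Vec 𝔽 n} {x} → u ◂ x → a ∷ᵥ u ◂ true ∷ᵥ x
  off : ∀ {u : Vec 𝔽 n} {x} → u ◂ x → 0F ∷ᵥ u ◂ false ∷ᵥ x

◂-⊕ : ∀ {u v : Vec 𝔽 n} {x} → u ◂ x → v ◂ x → u ⊕ᵥ v ◂ x
◂-⊕ []      []      = []
◂-⊕ (on p)  (on q)  = on (◂-⊕ p q)
◂-⊕ (off p) (off q) = off (◂-⊕ p q)

◂-⊗ : ∀ a {u : Vec 𝔽 n} {x} → u ◂ x → a ⊗ᵥ u ◂ x
◂-⊗ a []      = []
◂-⊗ a (on p)  = on (◂-⊗ a p)
◂-⊗ a (off p) rewrite ⊗-zeroʳ a = off (◂-⊗ a p)

◂-full : ∀ (u : Vec 𝔽 n) → u ◂ replicate n true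
◂-full []ᵥ      = []
◂-full (a ∷ᵥ u) = on (◂-full u)

𝟎-◂ : ∀ (x : Vec Bool n) → 𝟎 ◂ x
𝟎-◂ []ᵥ          = []
𝟎-◂ (true  ∷ᵥ x) = on (𝟎-◂ x)
𝟎-◂ (false ∷ᵥ x) = off (𝟎-◂ x)

_∪_ : Vec Bool n → Vec Bool n → Vec Bool n
_∪_ = zipWith _∨_

◂-∪ˡ : ∀ {u : Vec 𝔽 n} {x} y → u ◂ x → u ◂ x ∪ y
◂-∪ˡ []ᵥ          []      = []
◂-∪ˡ (_ ∷ᵥ y)     (on p)  = on (◂-∪ˡ y p)
◂-∪ˡ (true ∷ᵥ y)  (off p) = on (◂-∪ˡ y p)
◂-∪ˡ (false ∷ᵥ y) (off p) = off (◂-∪ˡ y p)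

◂-∪ʳ : ∀ {u : Vec 𝔽 n} x {y} → u ◂ y → u ◂ x ∪ y
◂-∪ʳ []ᵥ          []      = []
◂-∪ʳ (true ∷ᵥ x)  (on p)  = on (◂-∪ʳ x p)
◂-∪ʳ (false ∷ᵥ x) (on p)  = on (◂-∪ʳ x p)
◂-∪ʳ (true ∷ᵥ x)  (off p) = on (◂-∪ʳ x p)
◂-∪ʳ (false ∷ᵥ x) (off p) = off (◂-∪ʳ x p)

◂-remove : ∀ {u : Vec 𝔽 n} {x} i → u ◂ x → lookup u i ≡ 0F → u ◂ x [ i ]≔ false
◂-remove 0F          (on p)  refl = off p
◂-remove 0F          (off p) refl = off p
◂-remove (Fin.suc i) (on p)  uᵢ≡0 = on (◂-remove i p uᵢ≡0)
◂-remove (Fin.suc i) (off p) uᵢ≡0 = off (◂-remove i p uᵢ≡0)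

◂-lookup : ∀ {u : Vec 𝔽 n} {x} i → u ◂ x → lookup x i ≡ false → lookup u i ≡ 0F
◂-lookup 0F          (off p) xᵢ = refl
◂-lookup (Fin.suc i) (on p)  xᵢ = ◂-lookup i p xᵢ
◂-lookup (Fin.suc i) (off p) xᵢ = ◂-lookup i p xᵢ

weight-remove : ∀ (x : Vec Bool n) i → lookup x i ≡ true → weight x ≡ suc (weight (x [ i ]≔ false))
weight-remove (true  ∷ᵥ x) 0F          xᵢ = refl
weight-remove (true  ∷ᵥ x) (Fin.suc i) xᵢ = cong suc (weight-remove x i xᵢ)
weight-remove (false ∷ᵥ x) (Fin.suc i) xᵢ = weight-remove x i xᵢ

weight≢0⇒∃true : ∀ (x : Vec Bool n) → weight x ≡ suc d → ∃ λ i → lookup x i ≡ true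
weight≢0⇒∃true (true  ∷ᵥ x) _  = 0F , refl
weight≢0⇒∃true (false ∷ᵥ x) wx with weight≢0⇒∃true x wx
... | i , xᵢ = Fin.suc i , xᵢ

weight≤n : ∀ (x : Vec Bool n) → weight x ≤ n
weight≤n []ᵥ          = z≤n
weight≤n (true  ∷ᵥ x) = s≤s (weight≤n x)
weight≤n (false ∷ᵥ x) = m≤n⇒m≤1+n (weight≤n x)

scalars : List 𝔽
scalars = 0F ∷ 1F ∷ 2F ∷ 3F ∷ []

∈-scalars : ∀ a → a ∈ scalars
∈-scalars 0F = here refl
∈-scalars 1F = there (here refl)
∈-scalars 2F = there (there (here refl))
∈-scalars 3F = there (there (there (here refl)))

wordsOn : Vec Bool n → List (Vec 𝔽 n)
wordsOn []ᵥ          = []ᵥ ∷ []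
wordsOn (true  ∷ᵥ x) = cartesianProductWith _∷ᵥ_ scalars (wordsOn x)
wordsOn (false ∷ᵥ x) = map (0F ∷ᵥ_) (wordsOn x)

-- One word from each line of 𝔽^x.
monicsOn : Vec Bool n → List (Vec 𝔽 n)
monicsOn []ᵥ          = []
monicsOn (true  ∷ᵥ x) = map (1F ∷ᵥ_) (wordsOn x) ++ map (0F ∷ᵥ_) (monicsOn x)
monicsOn (false ∷ᵥ x) = map (0F ∷ᵥ_) (monicsOn x)

-- The leading entry 1 is all that the counts below need from `monicsOn`; the set `x` can be
-- forgotten.
data Monic : Vec 𝔽 n → Set where
  lead : ∀ {u : Vec 𝔽 n} → Monic (1F ∷ᵥ u)
  skip : ∀ {u : Vec 𝔽 n} → Monic u → Monic (0F ∷ᵥ u)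

monicsOn-monic : ∀ (x : Vec Bool n) → All Monic (monicsOn x)
monicsOn-monic []ᵥ          = []
monicsOn-monic (true  ∷ᵥ x) =
  ++⁺ (map⁺ (All.universal (λ _ → lead) (wordsOn x))) (map⁺ (All.map skip (monicsOn-monic x)))
monicsOn-monic (false ∷ᵥ x) = map⁺ (All.map skip (monicsOn-monic x))

length-wordsOn : ∀ (x : Vec Bool n) → length (wordsOn x) ≡ 4 ^ weight x
length-wordsOn []ᵥ          = refl
length-wordsOn (true  ∷ᵥ x) = begin
  length (wordsOn (true ∷ᵥ x))                  ≡⟨ length≡∑1 (wordsOn (true ∷ᵥ x)) ⟩
  ∑ (wordsOn (true ∷ᵥ x)) (λ _ → 1)             ≡⟨ ∑-cartesianProductWith _∷ᵥ_ scalars (wordsOn x) _ ⟩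
  ∑ scalars (λ _ → ∑ (wordsOn x) (λ _ → 1))     ≡⟨ cong (4 *_) (sym (length≡∑1 (wordsOn x))) ⟩
  4 * length (wordsOn x)                        ≡⟨ cong (4 *_) (length-wordsOn x) ⟩
  4 ^ weight (true ∷ᵥ x)                        ∎
  where open ≡-Reasoning
length-wordsOn (false ∷ᵥ x) = trans (length-map _ (wordsOn x)) (length-wordsOn x)

-- There are (4^w - 1)/3 lines in a space of dimension w, written without subtraction or division.
-- In the induction the new coordinate either leads, with a free tail, or is zero.
length-monicsOn : ∀ (x : Vec Bool n) → 1 + 3 * length (monicsOn x) ≡ 4 ^ weight x
length-monicsOn []ᵥ          = refl
length-monicsOn (true  ∷ᵥ x) = begin
  1 + 3 * length (monicsOn (true ∷ᵥ x))
    ≡⟨ cong (λ k → 1 + 3 * k) (length-++ (map (1F ∷ᵥ_) (wordsOn x))) ⟩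
  1 + 3 * (length (map (1F ∷ᵥ_) (wordsOn x)) + length (map (0F ∷ᵥ_) (monicsOn x)))
    ≡⟨ cong₂ (λ k l → 1 + 3 * (k + l)) (length-map _ (wordsOn x)) (length-map _ (monicsOn x)) ⟩
  1 + 3 * (length (wordsOn x) + length (monicsOn x))
    ≡⟨ regroup (length (wordsOn x)) (length (monicsOn x)) ⟩
  3 * length (wordsOn x) + (1 + 3 * length (monicsOn x))
    ≡⟨ cong₂ (λ k l → 3 * k + l) (length-wordsOn x) (length-monicsOn x) ⟩
  3 * 4 ^ weight x + 4 ^ weight x
    ≡⟨ +-comm (3 * 4 ^ weight x) (4 ^ weight x) ⟩
  4 ^ weight (true ∷ᵥ x) ∎
  where
  open ≡-Reasoning
  regroup : ∀ k l → 1 + 3 * (k + l) ≡ 3 * k + (1 + 3 * l)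
  regroup = solve-∀
length-monicsOn (false ∷ᵥ x) =
  trans (cong (λ k → 1 + 3 * k) (length-map _ (monicsOn x))) (length-monicsOn x)

◂⇒∈wordsOn : ∀ {u : Vec 𝔽 n} {x} → u ◂ x → u ∈ wordsOn x
◂⇒∈wordsOn []               = here refl
◂⇒∈wordsOn (on {a = a} p) = ∈-cartesianProductWith⁺ _∷ᵥ_ (∈-scalars a) (◂⇒∈wordsOn p)
◂⇒∈wordsOn (off p)          = ∈-map⁺ _ (◂⇒∈wordsOn p)

-- Divide by the first non-zero entry.
normalise : ∀ {u : Vec 𝔽 n} {x} → u ◂ x → u ≡ 𝟎 ⊎ ∃ λ a → a ⊗ᵥ u ∈ monicsOn x
normalise [] = inj₁ refl
normalise (on {a = a} {u} {x} p) with a Fin.≟ 0F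
... | no a≢0 = inj₂ (a ⁻¹ , subst (_∈ monicsOn (true ∷ᵥ x))
        (cong (_∷ᵥ (a ⁻¹ ⊗ᵥ u)) (sym (⁻¹-inverseˡ a a≢0)))
        (∈-++⁺ˡ (∈-map⁺ _ (◂⇒∈wordsOn (◂-⊗ (a ⁻¹) p)))))
... | yes refl with normalise p
...   | inj₁ refl    = inj₁ refl
...   | inj₂ (b , q) = inj₂ (b , subst (_∈ monicsOn (true ∷ᵥ x))
          (cong (_∷ᵥ (b ⊗ᵥ u)) (sym (⊗-zeroʳ b)))
          (∈-++⁺ʳ (map (1F ∷ᵥ_) (wordsOn x)) (∈-map⁺ _ q)))
normalise (off {u = u} {x} p) with normalise p
... | inj₁ refl    = inj₁ refl
... | inj₂ (b , q) = inj₂ (b , subst (_∈ monicsOn (false ∷ᵥ x))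
        (cong (_∷ᵥ (b ⊗ᵥ u)) (sym (⊗-zeroʳ b))) (∈-map⁺ _ q))

-- Degenerate sets of columns

killed : ∀ r → Matrix m n → Vec 𝔽 n → Bool
killed r φ u = isZeroᵥ (syndrome r φ u)

-- The number of rows tested equals the number of columns, so 4^w balances the number of words
-- against the probability that one is killed. Monic words suffice because being killed is invariant
-- under non-zero scaling.
degenerate : Matrix m n → Vec Bool n → Bool
degenerate φ x = any (killed (weight x) φ) (monicsOn x)

nondegenerate⇒independent : ∀ (φ : Matrix m n) {x u} → degenerate φ x ≡ false →
  u ◂ x → syndrome (weight x) φ u ≡ 𝟎 → u ≡ 𝟎
nondegenerate⇒independent φ {x} {u} nondeg u◂x syn≡𝟎 with normalise u◂x
... | inj₁ u≡𝟎     = u≡𝟎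
... | inj₂ (a , q) = ⊥-elim (true≢false (trans (sym isKilled) (any-false _ nondeg q)))
  where
  true≢false : true ≢ false
  true≢false ()
  isKilled : killed (weight x) φ (a ⊗ᵥ u) ≡ true
  isKilled = trans
    (cong isZeroᵥ (trans (syndrome-⊗ (weight x) φ a u) (trans (cong (a ⊗ᵥ_) syn≡𝟎) (⊗-𝟎 a))))
    (isZeroᵥ-𝟎 {weight x})

-- Counting over all matrices

words : ∀ n → List (Vec 𝔽 n)
words n = vecs scalars n

matrices : ∀ m n → List (Matrix m n)
matrices m n = vecs (words n) m

∑-isZero-⊕ : ∀ b → ∑ scalars (λ a → 𝟙 (isZero (a ⊕ b))) ≡ 1
∑-isZero-⊕ = from-yes (all? λ b → ∑ scalars (λ a → 𝟙 (isZero (a ⊕ b))) ≟ 1)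

-- The entry of the row facing the leading 1 is determined by the later entries, and the entries
-- before it are free: a quarter of all rows.
count-orthogonal : ∀ {u : Vec 𝔽 n} → Monic u →
  4 * ∑ (words n) (λ ρ → 𝟙 (isZero (dot u ρ))) ≡ 4 ^ n
count-orthogonal {suc n} (lead {u = u}) = cong (4 *_) (begin
  ∑ (words (suc n)) (λ ρ → 𝟙 (isZero (dot (1F ∷ᵥ u) ρ)))
    ≡⟨ ∑-cartesianProductWith _∷ᵥ_ scalars (words n) _ ⟩
  ∑ scalars (λ a → ∑ (words n) (λ ρ → 𝟙 (isZero (a ⊕ dot u ρ))))
    ≡⟨ ∑-comm scalars (words n) (λ a ρ → 𝟙 (isZero (a ⊕ dot u ρ))) ⟩
  ∑ (words n) (λ ρ → ∑ scalars (λ a → 𝟙 (isZero (a ⊕ dot u ρ))))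
    ≡⟨ ∑-cong (words n) (λ ρ → ∑-isZero-⊕ (dot u ρ)) ⟩
  ∑ (words n) (λ _ → 1)
    ≡⟨ length≡∑1 (words n) ⟨
  length (words n)
    ≡⟨ length-vecs scalars n ⟩
  4 ^ n ∎)
  where open ≡-Reasoning
count-orthogonal {suc n} (skip {u = u} p) = cong (4 *_) (begin
  ∑ (words (suc n)) (λ ρ → 𝟙 (isZero (dot (0F ∷ᵥ u) ρ)))
    ≡⟨ ∑-cartesianProductWith _∷ᵥ_ scalars (words n) _ ⟩
  ∑ scalars (λ _ → ∑ (words n) (λ ρ → 𝟙 (isZero (dot u ρ))))
    ≡⟨ ∑-const scalars (∑ (words n) (λ ρ → 𝟙 (isZero (dot u ρ)))) ⟩
  4 * ∑ (words n) (λ ρ → 𝟙 (isZero (dot u ρ)))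
    ≡⟨ count-orthogonal p ⟩
  4 ^ n ∎)
  where open ≡-Reasoning

length-matrices : ∀ m n → length (matrices m n) ≡ (4 ^ n) ^ m
length-matrices m n = trans (length-vecs (words n) m) (cong (_^ m) (length-vecs scalars n))

-- The first r rows are chosen independently, each orthogonal to `u` with probability 1/4. The bound
-- `r ≤ m` keeps the zero padding of `syndrome` out of play.
count-killed : ∀ {u : Vec 𝔽 n} → Monic u → r ≤ m →
  4 ^ r * ∑ (matrices m n) (λ φ → 𝟙 (killed r φ u)) ≡ (4 ^ n) ^ m
count-killed {n} {zero} {m} mon _ =
  trans (+-identityʳ _) (trans (sym (length≡∑1 (matrices m n))) (length-matrices m n))
count-killed {n} {suc r} {suc m} {u} mon (s≤s r≤m) = begin
  4 ^ suc r * ∑ (matrices (suc m) n) (λ φ → 𝟙 (killed (suc r) φ u))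
    ≡⟨ cong (4 ^ suc r *_) factor ⟩
  4 * 4 ^ r * (orth * kill)
    ≡⟨ regroup 4 (4 ^ r) orth kill ⟩
  4 * orth * (4 ^ r * kill)
    ≡⟨ cong₂ _*_ (count-orthogonal mon) (count-killed mon r≤m) ⟩
  4 ^ n * (4 ^ n) ^ m ∎
  where
  open ≡-Reasoning
  orth = ∑ (words n) (λ ρ → 𝟙 (isZero (dot u ρ)))
  kill = ∑ (matrices m n) (λ φ → 𝟙 (killed r φ u))
  regroup : ∀ a b c d → a * b * (c * d) ≡ a * c * (b * d)
  regroup = solve-∀
  factor : ∑ (matrices (suc m) n) (λ φ → 𝟙 (killed (suc r) φ u)) ≡ orth * kill
  factor = begin
    ∑ (matrices (suc m) n) (λ φ → 𝟙 (killed (suc r) φ u))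
      ≡⟨ ∑-cartesianProductWith _∷ᵥ_ (words n) (matrices m n) _ ⟩
    ∑ (words n) (λ ρ → ∑ (matrices m n) (λ φ → 𝟙 (isZero (dot u ρ) ∧ killed r φ u)))
      ≡⟨ ∑-cong (words n) (λ ρ → ∑-cong (matrices m n) (λ φ → 𝟙-∧ (isZero (dot u ρ)) _)) ⟩
    ∑ (words n) (λ ρ → ∑ (matrices m n) (λ φ → 𝟙 (isZero (dot u ρ)) * 𝟙 (killed r φ u)))
      ≡⟨ ∑-cong (words n) (λ ρ → ∑-distribˡ-* (matrices m n) (𝟙 (isZero (dot u ρ))) (λ φ → 𝟙 (killed r φ u))) ⟩
    ∑ (words n) (λ ρ → 𝟙 (isZero (dot u ρ)) * kill)
      ≡⟨ ∑-distribʳ-* (words n) kill _ ⟩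
    orth * kill ∎

count-degenerate : ∀ (x : Vec Bool n) → weight x ≤ m →
  3 * ∑ (matrices m n) (λ φ → 𝟙 (degenerate φ x)) ≤ (4 ^ n) ^ m
count-degenerate {n} {m} x w≤m = *-cancelˡ-≤ q (begin
  q * (3 * ∑ Φ (λ φ → 𝟙 (degenerate φ x)))
    ≤⟨ *-monoʳ-≤ q (*-monoʳ-≤ 3 (∑-mono Φ (λ φ → 𝟙-any (killed w φ) (monicsOn x)))) ⟩
  q * (3 * ∑ Φ (λ φ → ∑ (monicsOn x) (λ u → 𝟙 (killed w φ u))))
    ≡⟨ regroup q 3 _ ⟩
  3 * (q * ∑ Φ (λ φ → ∑ (monicsOn x) (λ u → 𝟙 (killed w φ u))))
    ≡⟨ cong (λ k → 3 * (q * k)) (∑-comm Φ (monicsOn x) _) ⟩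
  3 * (q * ∑ (monicsOn x) (λ u → ∑ Φ (λ φ → 𝟙 (killed w φ u))))
    ≡⟨ cong (3 *_) (∑-distribˡ-* (monicsOn x) q _) ⟨
  3 * ∑ (monicsOn x) (λ u → q * ∑ Φ (λ φ → 𝟙 (killed w φ u)))
    ≡⟨ cong (3 *_) (∑-const-All (All.map (λ mon → count-killed mon w≤m) (monicsOn-monic x))) ⟩
  3 * (length (monicsOn x) * (4 ^ n) ^ m)
    ≡⟨ *-assoc 3 (length (monicsOn x)) _ ⟨
  3 * length (monicsOn x) * (4 ^ n) ^ m
    -- Dropping the 1 in `length-monicsOn`, which counts the zero word, leaves 3 * length ≤ q.
    ≤⟨ *-monoˡ-≤ ((4 ^ n) ^ m) (≤-trans (n≤1+n _) (≤-reflexive (length-monicsOn x))) ⟩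
  q * (4 ^ n) ^ m ∎)
  where
  open ≤-Reasoning
  w = weight x
  q = 4 ^ w
  Φ = matrices m n
  instance
    q≢0 : NonZero q
    q≢0 = m^n≢0 4 w
  regroup : ∀ a b c → a * (b * c) ≡ b * (a * c)
  regroup = solve-∀

-- Double counting of pairs of a matrix and a degenerate set. With n rows, `weight x ≤ n` makes
-- `count-degenerate` apply to every `x`.
∃-few-degenerate : ∀ n → Σ (Matrix n n) λ φ → 3 * ∑ (cube n) (λ x → 𝟙 (degenerate φ x)) ≤ 2 ^ n
∃-few-degenerate n with ∃≤average (replicate n 𝟎) (matrices n n) (λ φ → ∑ (cube n) (λ x → 𝟙 (degenerate φ x)))
... | φ , φ≤ = φ , *-cancelˡ-≤ M (begin
  M * (3 * ∑ (cube n) (λ x → 𝟙 (degenerate φ x)))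
    ≡⟨ regroup M 3 _ ⟩
  3 * (M * ∑ (cube n) (λ x → 𝟙 (degenerate φ x)))
    ≡⟨ cong (λ k → 3 * (k * ∑ (cube n) (λ x → 𝟙 (degenerate φ x)))) (length-matrices n n) ⟨
  3 * (length (matrices n n) * ∑ (cube n) (λ x → 𝟙 (degenerate φ x)))
    ≤⟨ *-monoʳ-≤ 3 φ≤ ⟩
  3 * ∑ (matrices n n) (λ φ → ∑ (cube n) (λ x → 𝟙 (degenerate φ x)))
    ≡⟨ cong (3 *_) (∑-comm (matrices n n) (cube n) _) ⟩
  3 * ∑ (cube n) (λ x → ∑ (matrices n n) (λ φ → 𝟙 (degenerate φ x)))
    ≡⟨ ∑-distribˡ-* (cube n) 3 _ ⟨
  ∑ (cube n) (λ x → 3 * ∑ (matrices n n) (λ φ → 𝟙 (degenerate φ x)))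
    ≤⟨ ∑-mono (cube n) (λ x → count-degenerate x (weight≤n x)) ⟩
  ∑ (cube n) (λ _ → M)
    ≡⟨ ∑-const (cube n) M ⟩
  length (cube n) * M
    ≡⟨ cong (_* M) (length-cube n) ⟩
  2 ^ n * M
    ≡⟨ *-comm (2 ^ n) M ⟩
  M * 2 ^ n ∎)
  where
  open ≤-Reasoning
  M = (4 ^ n) ^ n
  instance
    4^n≢0 : NonZero (4 ^ n)
    4^n≢0 = m^n≢0 4 n
    M≢0 : NonZero M
    M≢0 = m^n≢0 (4 ^ n) n
  regroup : ∀ a b c → a * (b * c) ≡ b * (a * c)
  regroup = solve-∀

-- Existence of dependencies

encode : Vec 𝔽 r → Fin (4 ^ r)
encode []ᵥ      = 0F
encode (a ∷ᵥ u) = combine a (encode u)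

encode-injective : ∀ (u v : Vec 𝔽 r) → encode u ≡ encode v → u ≡ v
encode-injective []ᵥ      []ᵥ      _  = refl
encode-injective (a ∷ᵥ u) (b ∷ᵥ v) eq with combine-injective a (encode u) b (encode v) eq
... | refl , eq′ = cong (a ∷ᵥ_) (encode-injective u v eq′)

-- Numbers the words on `x`, so that the pigeonhole principle on `Fin` applies to them.
decodeOn : (x : Vec Bool n) → Fin (4 ^ weight x) → Vec 𝔽 n
decodeOn []ᵥ          _ = []ᵥ
decodeOn (true  ∷ᵥ x) i = proj₁ (remQuot {4} (4 ^ weight x) i) ∷ᵥ decodeOn x (proj₂ (remQuot {4} (4 ^ weight x) i))
decodeOn (false ∷ᵥ x) i = 0F ∷ᵥ decodeOn x i

decodeOn-◂ : ∀ (x : Vec Bool n) i → decodeOn x i ◂ x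
decodeOn-◂ []ᵥ          i = []
decodeOn-◂ (true  ∷ᵥ x) i = on (decodeOn-◂ x _)
decodeOn-◂ (false ∷ᵥ x) i = off (decodeOn-◂ x i)

decodeOn-injective : ∀ (x : Vec Bool n) i j → decodeOn x i ≡ decodeOn x j → i ≡ j
decodeOn-injective []ᵥ          0F 0F _ = refl
decodeOn-injective (true  ∷ᵥ x) i j eq with ∷-injective eq
... | heads , tails = begin
  i                                      ≡⟨ combine-remQuot {4} k i ⟨
  uncurry combine (remQuot {4} k i)      ≡⟨ cong₂ combine heads (decodeOn-injective x _ _ tails) ⟩
  uncurry combine (remQuot {4} k j)      ≡⟨ combine-remQuot {4} k j ⟩
  j                                      ∎
  where
  open ≡-Reasoning
  k = 4 ^ weight x
decodeOn-injective (false ∷ᵥ x) i j eq = decodeOn-injective x i j (proj₂ (∷-injective eq))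

-- More words than syndromes: two distinct words share a syndrome, and their sum, which is their
-- difference in characteristic two, is the dependency.
dependency : ∀ (φ : Matrix m n) x → r < weight x → ∃ λ u → u ◂ x × u ≢ 𝟎 × syndrome r φ u ≡ 𝟎
dependency {r = r} φ x r<w
  with pigeonhole (^-monoʳ-< 4 (s≤s (s≤s z≤n)) r<w) (λ i → encode (syndrome r φ (decodeOn x i)))
... | i , j , i<j , eq = u ⊕ᵥ v , ◂-⊕ (decodeOn-◂ x i) (decodeOn-◂ x j) , u⊕v≢𝟎 , (begin
  syndrome r φ (u ⊕ᵥ v)               ≡⟨ syndrome-⊕ r φ u v ⟩
  syndrome r φ u ⊕ᵥ syndrome r φ v    ≡⟨ cong (_⊕ᵥ syndrome r φ v) (encode-injective _ _ eq) ⟩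
  syndrome r φ v ⊕ᵥ syndrome r φ v    ≡⟨ ⊕ᵥ-self (syndrome r φ v) ⟩
  𝟎                                   ∎)
  where
  open ≡-Reasoning
  u = decodeOn x i
  v = decodeOn x j
  u⊕v≢𝟎 : u ⊕ᵥ v ≢ 𝟎
  u⊕v≢𝟎 u⊕v≡𝟎 = Finₚ.<⇒≢ i<j (decodeOn-injective x i j (⊕ᵥ≡𝟎⇒≡ u v u⊕v≡𝟎))

-- Codes of length seven

-- The support pattern of an MDS code of minimum distance d + 1.
record Tight (K : Vec 𝔽 n → Set) (d : ℕ) : Set where
  field
    ⊕-closed : ∀ {u v} → K u → K v → K (u ⊕ᵥ v)
    ⊗-closed : ∀ a {u} → K u → K (a ⊗ᵥ u)
    light    : ∀ {u} x → weight x ≡ d → K u → u ◂ x → u ≡ 𝟎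
    heavy    : ∀ x → weight x ≡ suc d → ∃ λ u → K u × u ◂ x × u ≢ 𝟎

-- Four supports through the common points `a` and `b`, the point `e i` telling each from the later
-- ones. Two of the four words will be proportional on `a` and `b`. A star covers at least d + 4
-- points, so on seven points it serves d ≤ 3 only. Ordered pairs suffice since the pigeonhole
-- returns `i < j`.
IsStar : ℕ → (a b : Fin n) (x : Fin 4 → Vec Bool n) (e : Fin 4 → Fin n) → Set
IsStar d a b x e =
  (∀ i → weight (x i) ≡ suc d × lookup (x i) a ≡ true × lookup (x i) b ≡ true × lookup (x i) (e i) ≡ true) ×
  (∀ i j → i Fin.< j → lookup (x j) (e i) ≡ false × weight ((x i ∪ x j) [ a ]≔ false [ b ]≔ false) ≡ d)

isStar? : ∀ d (a b : Fin n) x e → Dec (IsStar d a b x e)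
isStar? d a b x e =
  (all? λ i → (weight (x i) ≟ suc d) ×-dec (lookup (x i) a ≟ᵇ true) ×-dec
    (lookup (x i) b ≟ᵇ true) ×-dec (lookup (x i) (e i) ≟ᵇ true)) ×-dec
  (all? λ i → all? λ j → (i Finₚ.<? j) →-dec
    ((lookup (x j) (e i) ≟ᵇ false) ×-dec (weight ((x i ∪ x j) [ a ]≔ false [ b ]≔ false) ≟ d)))

-- The dual pattern: two supports sharing four points, on two of which the two words will be
-- proportional. Together with `e` this forces d ≥ 4, where stars no longer fit.
IsBook : ℕ → (a : Fin 4 → Fin n) (x y : Vec Bool n) (e : Fin n) → Set
IsBook d a x y e =
  (weight x ≡ suc d × weight y ≡ suc d × lookup x e ≡ true × lookup y e ≡ false) ×
  (∀ i → lookup x (a i) ≡ true × lookup y (a i) ≡ true) ×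
  (∀ i j → i Fin.< j → weight ((x ∪ y) [ a i ]≔ false [ a j ]≔ false) ≡ d)

isBook? : ∀ d (a : Fin 4 → Fin n) x y e → Dec (IsBook d a x y e)
isBook? d a x y e =
  ((weight x ≟ suc d) ×-dec (weight y ≟ suc d) ×-dec (lookup x e ≟ᵇ true) ×-dec (lookup y e ≟ᵇ false)) ×-dec
  (all? λ i → (lookup x (a i) ≟ᵇ true) ×-dec (lookup y (a i) ≟ᵇ true)) ×-dec
  (all? λ i → all? λ j → (i Finₚ.<? j) →-dec (weight ((x ∪ y) [ a i ]≔ false [ a j ]≔ false) ≟ d))

module _ {K : Vec 𝔽 n → Set} {d : ℕ} (tight : Tight K d) where
  open Tight tight

  -- A zero inside `x` would leave a word on d points, which `light` forbids.
  heavy-full : ∀ x → weight x ≡ suc d →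
    ∃ λ u → K u × u ◂ x × (∀ i → lookup x i ≡ true → lookup u i ≢ 0F)
  heavy-full x wx with heavy x wx
  ... | u , Ku , u◂x , u≢𝟎 = u , Ku , u◂x , λ i xᵢ uᵢ≡0 → u≢𝟎
    (light (x [ i ]≔ false) (suc-injective (trans (sym (weight-remove x i xᵢ)) wx)) Ku (◂-remove i u◂x uᵢ≡0))

  -- The word u + ρv vanishes at `a` and `b`. If only d points remained it would be zero by `light`,
  -- yet at `e` it agrees with `u`.
  no-proportional-pair : ∀ {u v} x y a b e ρ → K u → K v → u ◂ x → v ◂ y →
    lookup u e ≢ 0F → lookup y e ≡ false →
    lookup u a ⊕ ρ ⊗ lookup v a ≡ 0F → lookup u b ⊕ ρ ⊗ lookup v b ≡ 0F →
    weight ((x ∪ y) [ a ]≔ false [ b ]≔ false) ≢ d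
  no-proportional-pair {u} {v} x y a b e ρ Ku Kv u◂x v◂y uₑ≢0 yₑ cancel-a cancel-b wz = uₑ≢0 (begin
    lookup u e                    ≡⟨ ⊕-identityʳ (lookup u e) ⟨
    lookup u e ⊕ 0F               ≡⟨ cong (lookup u e ⊕_) (⊗-zeroʳ ρ) ⟨
    lookup u e ⊕ ρ ⊗ 0F           ≡⟨ cong (λ c → lookup u e ⊕ ρ ⊗ c) (◂-lookup e v◂y yₑ) ⟨
    lookup u e ⊕ ρ ⊗ lookup v e   ≡⟨ lookup-w e ⟨
    lookup w e                    ≡⟨ cong (λ c → lookup c e) w≡𝟎 ⟩
    lookup 𝟎 e                    ≡⟨ lookup-replicate e 0F ⟩
    0F                            ∎)
    where
    open ≡-Reasoning
    w = u ⊕ᵥ ρ ⊗ᵥ v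
    lookup-w : ∀ i → lookup w i ≡ lookup u i ⊕ ρ ⊗ lookup v i
    lookup-w i = trans (lookup-zipWith _⊕_ i u (ρ ⊗ᵥ v)) (cong (lookup u i ⊕_) (lookup-map i (ρ ⊗_) v))
    w≡𝟎 : w ≡ 𝟎
    w≡𝟎 = light _ wz (⊕-closed Ku (⊗-closed ρ Kv))
      (◂-remove b (◂-remove a (◂-⊕ (◂-∪ˡ y u◂x) (◂-∪ʳ x (◂-⊗ ρ v◂y)))
        (trans (lookup-w a) cancel-a)) (trans (lookup-w b) cancel-b))

  no-star : ∀ a b x e → ¬ IsStar d a b x e
  no-star a b x e (on-x , off-x) = clash (𝔽-pigeonhole ratio ratio≢0)
    where
    u : Fin 4 → Vec 𝔽 n
    u i = proj₁ (heavy-full (x i) (proj₁ (on-x i)))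
    Ku : ∀ i → K (u i)
    Ku i = proj₁ (proj₂ (heavy-full (x i) (proj₁ (on-x i))))
    u◂x : ∀ i → u i ◂ x i
    u◂x i = proj₁ (proj₂ (proj₂ (heavy-full (x i) (proj₁ (on-x i)))))
    full : ∀ i p → lookup (x i) p ≡ true → lookup (u i) p ≢ 0F
    full i = proj₂ (proj₂ (proj₂ (heavy-full (x i) (proj₁ (on-x i)))))
    uₐ≢0 : ∀ i → lookup (u i) a ≢ 0F
    uₐ≢0 i = full i a (proj₁ (proj₂ (on-x i)))
    ratio : Fin 4 → 𝔽
    ratio i = lookup (u i) b ⊗ lookup (u i) a ⁻¹
    ratio≢0 : ∀ i → ratio i ≢ 0F
    ratio≢0 i = ⊗≢0 (lookup (u i) b) (lookup (u i) a ⁻¹)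
      (full i b (proj₁ (proj₂ (proj₂ (on-x i))))) (⁻¹≢0 (lookup (u i) a) (uₐ≢0 i))
    clash : ¬ (∃₂ λ i j → i Fin.< j × ratio i ≡ ratio j)
    clash (i , j , i<j , eq) =
      -- The scalar cancels coordinate `a`; equality of the ratios b : a then cancels `b` as well.
      no-proportional-pair (x i) (x j) a b (e i) (lookup (u i) a ⊗ lookup (u j) a ⁻¹)
        (Ku i) (Ku j) (u◂x i) (u◂x j)
        (full i (e i) (proj₂ (proj₂ (proj₂ (on-x i))))) (proj₁ (off-x i j i<j))
        (⊕-cancel-quotient (lookup (u i) a) (lookup (u j) a) (uₐ≢0 j))
        (⊕-cancel-proportion (lookup (u i) a) (lookup (u j) a) (lookup (u i) b) (lookup (u j) b)
          (uₐ≢0 i) (uₐ≢0 j) eq)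
        (proj₂ (off-x i j i<j))

  no-book : ∀ a x y e → ¬ IsBook d a x y e
  no-book a x y e ((wx , wy , xₑ , yₑ) , on-xy , wz) = clash (heavy-full x wx) (heavy-full y wy)
    where
    clash : (∃ λ u → K u × u ◂ x × (∀ i → lookup x i ≡ true → lookup u i ≢ 0F)) →
            ¬ (∃ λ v → K v × v ◂ y × (∀ i → lookup y i ≡ true → lookup v i ≢ 0F))
    clash (u , Ku , u◂x , u-full) (v , Kv , v◂y , v-full) = repeated (𝔽-pigeonhole ratio ratio≢0)
      where
      vₐ≢0 : ∀ i → lookup v (a i) ≢ 0F
      vₐ≢0 i = v-full (a i) (proj₂ (on-xy i))
      ratio : Fin 4 → 𝔽
      ratio i = lookup u (a i) ⊗ lookup v (a i) ⁻¹
      ratio≢0 : ∀ i → ratio i ≢ 0F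
      ratio≢0 i = ⊗≢0 (lookup u (a i)) (lookup v (a i) ⁻¹)
        (u-full (a i) (proj₁ (on-xy i))) (⁻¹≢0 (lookup v (a i)) (vₐ≢0 i))
      repeated : ¬ (∃₂ λ i j → i Fin.< j × ratio i ≡ ratio j)
      repeated (i , j , i<j , eq) =
        -- Here the repeated ratio itself is the scalar, cancelling at both `a i` and `a j`.
        no-proportional-pair x y (a i) (a j) e (ratio i) Ku Kv u◂x v◂y (u-full e xₑ) yₑ
          (⊕-cancel-quotient (lookup u (a i)) (lookup v (a i)) (vₐ≢0 i))
          (trans (cong (λ ρ → lookup u (a j) ⊕ ρ ⊗ lookup v (a j)) eq)
            (⊕-cancel-quotient (lookup u (a j)) (lookup v (a j)) (vₐ≢0 j)))
          (wz i j i<j)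

private
  tip : Fin 4 → Fin 7
  tip i = 2 Fin.↑ʳ (i Fin.↑ˡ 1)

  -- Common points 0 and 1 with one tip among 2 to 5; the flag adds point 6 to every set, which
  -- raises d from 2 to 3.
  starSet : Bool → Fin 4 → Vec Bool 7
  starSet b i = (true ∷ᵥ true ∷ᵥ false ∷ᵥ false ∷ᵥ false ∷ᵥ false ∷ᵥ b ∷ᵥ []ᵥ) [ tip i ]≔ true

  -- Common points 0 to 3, with `c` choosing between 4 and 5; the flag `b` adds point 6 and raises d
  -- from 4 to 5.
  bookSet : Bool → Bool → Vec Bool 7
  bookSet b c = true ∷ᵥ true ∷ᵥ true ∷ᵥ true ∷ᵥ c ∷ᵥ not c ∷ᵥ b ∷ᵥ []ᵥ

-- The length is a variable with an equation because it will be `weight I`, which equals 7 only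
-- propositionally.
¬Tight-2 : n ≡ 7 → {K : Vec 𝔽 n → Set} → ¬ Tight K 2
¬Tight-2 refl tight = no-star tight 0F 1F (starSet false) tip (from-yes (isStar? 2 0F 1F (starSet false) tip))

¬Tight-3 : n ≡ 7 → {K : Vec 𝔽 n → Set} → ¬ Tight K 3
¬Tight-3 refl tight = no-star tight 0F 1F (starSet true) tip (from-yes (isStar? 3 0F 1F (starSet true) tip))

¬Tight-4 : n ≡ 7 → {K : Vec 𝔽 n → Set} → ¬ Tight K 4
¬Tight-4 refl tight = no-book tight (Fin._↑ˡ 3) (bookSet false true) (bookSet false false) 4F
  (from-yes (isBook? 4 (Fin._↑ˡ 3) (bookSet false true) (bookSet false false) 4F))

¬Tight-5 : n ≡ 7 → {K : Vec 𝔽 n → Set} → ¬ Tight K 5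
¬Tight-5 refl tight = no-book tight (Fin._↑ˡ 3) (bookSet true true) (bookSet true false) 4F
  (from-yes (isBook? 5 (Fin._↑ˡ 3) (bookSet true true) (bookSet true false) 4F))

-- Subcubes

-- Parametrises the subcube by subsets X of the free set T, the mask `I`. The entries of `a` outside
-- `I` form the stem S, so the result is S ∪ X.
fill : (I a : Vec Bool n) → Vec Bool (weight I) → Vec Bool n
fill []ᵥ          []ᵥ      x        = []ᵥ
fill (true  ∷ᵥ I) (_ ∷ᵥ a) (b ∷ᵥ x) = b ∷ᵥ fill I a x
fill (false ∷ᵥ I) (b ∷ᵥ a) x        = b ∷ᵥ fill I a x

fill-InSubcube : ∀ (I a : Vec Bool n) x → InSubcube I a (fill I a x)
fill-InSubcube (true  ∷ᵥ I) (_ ∷ᵥ a) (b ∷ᵥ x) (Fin.suc i) Iᵢ = fill-InSubcube I a x i Iᵢ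
fill-InSubcube (false ∷ᵥ I) (b ∷ᵥ a) x        0F          Iᵢ = refl
fill-InSubcube (false ∷ᵥ I) (b ∷ᵥ a) x        (Fin.suc i) Iᵢ = fill-InSubcube I a x i Iᵢ

stemWeight : Vec Bool n → Vec Bool n → ℕ
stemWeight I a = weight (fill I a (replicate (weight I) false))

weight-fill : ∀ (I a : Vec Bool n) x → weight (fill I a x) ≡ weight x + stemWeight I a
weight-fill []ᵥ          []ᵥ          []ᵥ          = refl
weight-fill (true  ∷ᵥ I) (_ ∷ᵥ a)     (true  ∷ᵥ x) = cong suc (weight-fill I a x)
weight-fill (true  ∷ᵥ I) (_ ∷ᵥ a)     (false ∷ᵥ x) = weight-fill I a x
weight-fill (false ∷ᵥ I) (true  ∷ᵥ a) x            =
  trans (cong suc (weight-fill I a x)) (sym (+-suc (weight x) _))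
weight-fill (false ∷ᵥ I) (false ∷ᵥ a) x            = weight-fill I a x

pick : (I : Vec Bool n) → Vec 𝔽 n → Vec 𝔽 (weight I)
pick []ᵥ          []ᵥ      = []ᵥ
pick (true  ∷ᵥ I) (a ∷ᵥ u) = a ∷ᵥ pick I u
pick (false ∷ᵥ I) (a ∷ᵥ u) = pick I u

pick-⊕ : ∀ (I : Vec Bool n) u v → pick I (u ⊕ᵥ v) ≡ pick I u ⊕ᵥ pick I v
pick-⊕ []ᵥ          []ᵥ      []ᵥ      = refl
pick-⊕ (true  ∷ᵥ I) (a ∷ᵥ u) (b ∷ᵥ v) = cong (a ⊕ b ∷ᵥ_) (pick-⊕ I u v)
pick-⊕ (false ∷ᵥ I) (a ∷ᵥ u) (b ∷ᵥ v) = pick-⊕ I u v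

pick-⊗ : ∀ (I : Vec Bool n) a u → pick I (a ⊗ᵥ u) ≡ a ⊗ᵥ pick I u
pick-⊗ []ᵥ          a []ᵥ      = refl
pick-⊗ (true  ∷ᵥ I) a (b ∷ᵥ u) = cong (a ⊗ b ∷ᵥ_) (pick-⊗ I a u)
pick-⊗ (false ∷ᵥ I) a (b ∷ᵥ u) = pick-⊗ I a u

pick-𝟎 : ∀ (I : Vec Bool n) → pick I 𝟎 ≡ 𝟎
pick-𝟎 []ᵥ          = refl
pick-𝟎 (true  ∷ᵥ I) = cong (0F ∷ᵥ_) (pick-𝟎 I)
pick-𝟎 (false ∷ᵥ I) = pick-𝟎 I

pick-◂ : ∀ (I a : Vec Bool n) x {u} → u ◂ fill I a x → pick I u ◂ x
pick-◂ []ᵥ          []ᵥ          []ᵥ          []      = []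
pick-◂ (true  ∷ᵥ I) (_ ∷ᵥ a)     (true  ∷ᵥ x) (on p)  = on (pick-◂ I a x p)
pick-◂ (true  ∷ᵥ I) (_ ∷ᵥ a)     (false ∷ᵥ x) (off p) = off (pick-◂ I a x p)
pick-◂ (false ∷ᵥ I) (true  ∷ᵥ a) x            (on p)  = pick-◂ I a x p
pick-◂ (false ∷ᵥ I) (false ∷ᵥ a) x            (off p) = pick-◂ I a x p

-- Fillings differ only on the free coordinates, and there the support is controlled by `pick`.
◂-fill : ∀ (I a : Vec Bool n) x y {u} → u ◂ fill I a y → pick I u ◂ x → u ◂ fill I a x
◂-fill []ᵥ          []ᵥ          []ᵥ      []ᵥ          []      q       = []
◂-fill (true  ∷ᵥ I) (_ ∷ᵥ a)     (_ ∷ᵥ x) (true  ∷ᵥ y) (on p)  (on q)  = on (◂-fill I a x y p q)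
◂-fill (true  ∷ᵥ I) (_ ∷ᵥ a)     (_ ∷ᵥ x) (true  ∷ᵥ y) (on p)  (off q) = off (◂-fill I a x y p q)
◂-fill (true  ∷ᵥ I) (_ ∷ᵥ a)     (_ ∷ᵥ x) (false ∷ᵥ y) (off p) (on q)  = on (◂-fill I a x y p q)
◂-fill (true  ∷ᵥ I) (_ ∷ᵥ a)     (_ ∷ᵥ x) (false ∷ᵥ y) (off p) (off q) = off (◂-fill I a x y p q)
◂-fill (false ∷ᵥ I) (true  ∷ᵥ a) x        y            (on p)  q       = on (◂-fill I a x y p q)
◂-fill (false ∷ᵥ I) (false ∷ᵥ a) x        y            (off p) q       = off (◂-fill I a x y p q)

module _ (φ : Matrix m n) (I a : Vec Bool n) (d : ℕ) where
  private
    -- All sets S ∪ X with |X| = d have `t` elements, so one row count serves the whole layer.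
    t = d + stemWeight I a
    top = fill I a (replicate (weight I) true)

  Dependencies : Vec 𝔽 (weight I) → Set
  Dependencies u = ∃ λ c → syndrome t φ c ≡ 𝟎 × c ◂ top × pick I c ≡ u

  -- For `light`, a dependency projecting into X lives on S ∪ X, whose `t` columns are independent.
  -- For `heavy`, S ∪ X with |X| = d + 1 has more columns than the `t` rows.
  dependencies-tight :
    (∀ x → weight x ≡ d → degenerate φ (fill I a x) ≡ false) → Tight Dependencies d
  dependencies-tight nondeg = record
    { ⊕-closed = λ { {u} {v} (c , sc , c◂ , refl) (c′ , sc′ , c′◂ , refl) →
        c ⊕ᵥ c′ , trans (syndrome-⊕ t φ c c′) (trans (cong₂ _⊕ᵥ_ sc sc′) 𝟎-⊕) , ◂-⊕ c◂ c′◂ , pick-⊕ I c c′ }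
    ; ⊗-closed = λ { b (c , sc , c◂ , refl) →
        b ⊗ᵥ c , trans (syndrome-⊗ t φ b c) (trans (cong (b ⊗ᵥ_) sc) (⊗-𝟎 b)) , ◂-⊗ b c◂ , pick-⊗ I b c }
    ; light = λ { x wx (c , sc , c◂ , refl) u◂x →
        trans (cong (pick I) (independent x wx sc (◂-fill I a x _ c◂ u◂x))) (pick-𝟎 I) }
    ; heavy = heavy
    }
    where
    independent : ∀ x {c} → weight x ≡ d → syndrome t φ c ≡ 𝟎 → c ◂ fill I a x → c ≡ 𝟎
    independent x {c} wx sc c◂ = nondegenerate⇒independent φ (nondeg x wx) c◂
      (subst (λ k → syndrome k φ c ≡ 𝟎) (sym (trans (weight-fill I a x) (cong (_+ stemWeight I a) wx))) sc)
    heavy : ∀ x → weight x ≡ suc d → ∃ λ u → Dependencies u × u ◂ x × u ≢ 𝟎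
    heavy x wx with dependency {r = t} φ (fill I a x)
                      (≤-reflexive (sym (trans (weight-fill I a x) (cong (_+ stemWeight I a) wx))))
    ... | c , c◂ , c≢𝟎 , sc = pick I c , (c , sc , ◂-fill I a _ x c◂ (◂-full (pick I c)) , refl)
                            , pick-◂ I a x c◂ , pick≢𝟎
      where
      pick≢𝟎 : pick I c ≢ 𝟎
      pick≢𝟎 pc≡𝟎 with weight≢0⇒∃true x wx
      -- A dependency with zero projection lives on S alone, hence on S ∪ y for a d-set `y`,
      -- contradicting independence there.
      ... | i , xᵢ = c≢𝟎 (independent y (suc-injective (trans (sym (weight-remove x i xᵢ)) wx)) sc
              (◂-fill I a y x c◂ (subst (_◂ y) (sym pc≡𝟎) (𝟎-◂ y))))
        where y = x [ i ]≔ false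

-- The construction by weight modulo 4

next : Fin 4 → Fin 4
next 0F = 1F
next 1F = 2F
next 2F = 3F
next 3F = 0F

-- Defined by recursion so that `residue (s + w)` unfolds, for numeral s, to s applications of
-- `next`.
residue : ℕ → Fin 4
residue zero    = 0F
residue (suc k) = next (residue k)

omitted : Fin 4 → Matrix m n → Vec Bool n → Bool
omitted k φ x = ⌊ k Fin.≟ residue (weight x) ⌋ ∧ degenerate φ x

avoiding : Fin 4 → Matrix m n → VSet n
avoiding k φ x = not (omitted k φ x)

-- Four consecutive weights meet every class; after unfolding, a check over all pairs in `Fin 4` is
-- enough.
middle-layer : ∀ k w →
  k ≡ residue (2 + w) ⊎ k ≡ residue (3 + w) ⊎ k ≡ residue (4 + w) ⊎ k ≡ residue (5 + w)
middle-layer k w = shifts k (residue w)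
  where
  shifts : ∀ k p → k ≡ next (next p) ⊎ k ≡ next (next (next p)) ⊎
    k ≡ next (next (next (next p))) ⊎ k ≡ next (next (next (next (next p))))
  shifts = from-yes (all? λ k → all? λ p →
    (k Fin.≟ next (next p)) ⊎-dec (k Fin.≟ next (next (next p))) ⊎-dec
    (k Fin.≟ next (next (next (next p)))) ⊎-dec (k Fin.≟ next (next (next (next (next p))))))

avoiding⇒nondegenerate : ∀ k (φ : Matrix m n) x → k ≡ residue (weight x) →
  avoiding k φ x ≡ true → degenerate φ x ≡ false
avoiding⇒nondegenerate k φ x k≡ x∈A with k Fin.≟ residue (weight x) | degenerate φ x
... | yes _  | false = refl
... | no k≢  | _     = ⊥-elim (k≢ k≡)

-- In the layer of class `k`, membership means nondegeneracy, so a copy would produce a tight code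
-- of length seven with d from 2 to 5.
avoiding-Q7Free : ∀ k (φ : Matrix m n) → QdFree 7 (avoiding k φ)
avoiding-Q7Free k φ (I , a , wI , copy) with middle-layer k (stemWeight I a)
... | layer = exclude layer
  where
  tight : ∀ s → k ≡ residue (s + stemWeight I a) → Tight (Dependencies φ I a s) s
  tight s k≡ = dependencies-tight φ I a s λ x wx → avoiding⇒nondegenerate k φ (fill I a x)
    (trans k≡ (cong residue (sym (trans (weight-fill I a x) (cong (_+ stemWeight I a) wx)))))
    (copy (fill I a x) (fill-InSubcube I a x))
  exclude : k ≡ residue (2 + stemWeight I a) ⊎ k ≡ residue (3 + stemWeight I a) ⊎
    k ≡ residue (4 + stemWeight I a) ⊎ k ≡ residue (5 + stemWeight I a) → ⊥
  exclude (inj₁ k≡)               = ¬Tight-2 wI (tight 2 k≡)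
  exclude (inj₂ (inj₁ k≡))        = ¬Tight-3 wI (tight 3 k≡)
  exclude (inj₂ (inj₂ (inj₁ k≡))) = ¬Tight-4 wI (tight 4 k≡)
  exclude (inj₂ (inj₂ (inj₂ k≡))) = ¬Tight-5 wI (tight 5 k≡)

-- Density of the construction

∑-scalars-≟ : ∀ j → ∑ scalars (λ k → 𝟙 ⌊ k Fin.≟ j ⌋) ≡ 1
∑-scalars-≟ = from-yes (all? λ j → ∑ scalars (λ k → 𝟙 ⌊ k Fin.≟ j ⌋) ≟ 1)

-- Each degenerate set is omitted for exactly one class. Here `scalars` doubles as the list of the
-- four residue classes.
∑-omitted : ∀ (φ : Matrix m n) →
  ∑ scalars (λ k → ∑ (cube n) (λ x → 𝟙 (omitted k φ x))) ≡ ∑ (cube n) (λ x → 𝟙 (degenerate φ x))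
∑-omitted {n = n} φ = begin
  ∑ scalars (λ k → ∑ (cube n) (λ x → 𝟙 (omitted k φ x)))
    ≡⟨ ∑-comm scalars (cube n) (λ k x → 𝟙 (omitted k φ x)) ⟩
  ∑ (cube n) (λ x → ∑ scalars (λ k → 𝟙 (omitted k φ x)))
    ≡⟨ ∑-cong (cube n) one-residue ⟩
  ∑ (cube n) (λ x → 𝟙 (degenerate φ x)) ∎
  where
  open ≡-Reasoning
  one-residue : ∀ x → ∑ scalars (λ k → 𝟙 (omitted k φ x)) ≡ 𝟙 (degenerate φ x)
  one-residue x = begin
    ∑ scalars (λ k → 𝟙 (omitted k φ x))
      ≡⟨ ∑-cong scalars (λ k → 𝟙-∧ ⌊ k Fin.≟ residue (weight x) ⌋ (degenerate φ x)) ⟩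
    ∑ scalars (λ k → 𝟙 ⌊ k Fin.≟ residue (weight x) ⌋ * 𝟙 (degenerate φ x))
      ≡⟨ ∑-distribʳ-* scalars (𝟙 (degenerate φ x)) (λ k → 𝟙 ⌊ k Fin.≟ residue (weight x) ⌋) ⟩
    ∑ scalars (λ k → 𝟙 ⌊ k Fin.≟ residue (weight x) ⌋) * 𝟙 (degenerate φ x)
      ≡⟨ cong (_* 𝟙 (degenerate φ x)) (∑-scalars-≟ (residue (weight x))) ⟩
    1 * 𝟙 (degenerate φ x)
      ≡⟨ *-identityˡ _ ⟩
    𝟙 (degenerate φ x) ∎

-- Degenerate sets have density at most 1/3, and the best of four classes takes at most a quarter of
-- them.
∃-few-omitted : ∀ n → ∃₂ λ k (φ : Matrix n n) → 12 * ∑ (cube n) (λ x → 𝟙 (omitted k φ x)) ≤ 2 ^ n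
∃-few-omitted n with ∃-few-degenerate n
... | φ , φ≤ with ∃≤average 0F scalars (λ k → ∑ (cube n) (λ x → 𝟙 (omitted k φ x)))
... | k , k≤ = k , φ , (begin
  12 * ∑ (cube n) (λ x → 𝟙 (omitted k φ x))
    ≡⟨ *-assoc 3 4 (∑ (cube n) (λ x → 𝟙 (omitted k φ x))) ⟩
  3 * (4 * ∑ (cube n) (λ x → 𝟙 (omitted k φ x)))
    ≤⟨ *-monoʳ-≤ 3 k≤ ⟩
  3 * ∑ scalars (λ k → ∑ (cube n) (λ x → 𝟙 (omitted k φ x)))
    ≡⟨ cong (3 *_) (∑-omitted φ) ⟩
  3 * ∑ (cube n) (λ x → 𝟙 (degenerate φ x))
    ≤⟨ φ≤ ⟩
  2 ^ n ∎)
  where open ≤-Reasoning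

size-complement : ∀ (B : VSet n) → size (not ∘ B) + size B ≡ 2 ^ n
size-complement {n} B = begin
  size (not ∘ B) + size B                  ≡⟨ ∑-distrib-+ (cube n) (λ x → 𝟙 (not (B x))) (λ x → 𝟙 (B x)) ⟨
  ∑ (cube n) (λ x → 𝟙 (not (B x)) + 𝟙 (B x)) ≡⟨ ∑-cong (cube n) (λ x → 𝟙-not (B x)) ⟩
  ∑ (cube n) (λ _ → 1)                     ≡⟨ length≡∑1 (cube n) ⟨
  length (cube n)                          ≡⟨ length-cube n ⟩
  2 ^ n                                    ∎
  where open ≡-Reasoning

theorem2 : Σ ℕ λ p → Σ ℕ λ q → (0 < q) × (7 * q < 8 * p) ×
    Σ ℕ λ N → (n : ℕ) → N ≤ n →
    Σ (VSet n) λ A → QdFree 7 A × (p * 2 ^ n ≤ q * size A)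
-- The density is 1 - 1/12 = 11/12, and 7 * 12 = 84 < 88 = 8 * 11. The bound holds in every
-- dimension, hence the threshold 0.
theorem2 = 11 , 12 , from-yes (0 <? 12) , from-yes (84 <? 88) , 0 , λ n _ → dense n (∃-few-omitted n)
  where
  dense : ∀ n → (∃₂ λ k (φ : Matrix n n) → 12 * size (omitted k φ) ≤ 2 ^ n) →
    Σ (VSet n) λ A → QdFree 7 A × (11 * 2 ^ n ≤ 12 * size A)
  dense n (k , φ , few) = A , avoiding-Q7Free k φ , +-cancelʳ-≤ (2 ^ n) _ _ (begin
    11 * 2 ^ n + 2 ^ n             ≡⟨ +-comm (11 * 2 ^ n) (2 ^ n) ⟩
    12 * 2 ^ n                     ≡⟨ cong (12 *_) (size-complement B) ⟨
    12 * (size A + size B)         ≡⟨ *-distribˡ-+ 12 (size A) (size B) ⟩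
    12 * size A + 12 * size B      ≤⟨ +-monoʳ-≤ (12 * size A) few ⟩
    12 * size A + 2 ^ n            ∎)
    where
    open ≤-Reasoning
    A = avoiding k φ
    B = omitted k φ
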